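{- For every integer $d\ge 1$, there exists a least positive integer $n_d\ge 2$ such that for every integer $n\ge n_d$, the poset $\operatorname{Kelly}(n,d)$ satisfies $\operatorname{ldim}(\operatorname{Kelly}(n,d))\ge d$.
   Context: All posets are finite. A partial linear extension (ple) of a poset $P$ is a linear extension of a subposet of $P$. For a family $\mathcal{L}$ of ple's of $P$ and $u\in P$, let $\mu(u,\mathcal{L})=|\{L\in\mathcal{L}: u\in L\}|$ and $\mu(P,\mathcal{L})=\max_{u\in P}\mu(u,\mathcal{L})$. A family $\mathcal{L}$ of ple's of $P$ is a local realizer of $P$ if (1) whenever $x<y$ in $P$ there is $L\in\mathcal{L}$ with $x<y$ in $L$, and (2) whenever $x,y$ are incomparable in $P$ there is $L\in\mathcal{L}$ with $x>y$ in $L$. The local dimension $\operatorname{ldim}(P)$ is the least positive integer $d$ such that $P$ has a local realizer $\mathcal{L}$ with $\mu(P,\mathcal{L})=d$. Kelly construction: for $n\ge 2$, $K_n$ is the poset on $\{a_1,\dots,a_n,b_1,\dots,b_n,w_1,\dots,w_{n-1},z_1,\dots,z_{n-1}\}$ whose order is the transitive closure of the relations $a_i<w_i<b_{i+1}$ and $a_{i+1}<z_i<b_i$ for $1\le i\le n-1$, $w_i<w_{i+1}$ and $z_{i+1}<z_i$ for $1\le i\le n-2$. (Then $a_i<b_j$ iff $i\ne j$.) Posets $\operatorname{Kelly}(n,d)$, $n\ge2$, $d\ge1$, whose elements are finite sequences: $\operatorname{Kelly}(n,1)=K_n$, each element $x$ viewed as the length-one sequence $(x)$. Given $\operatorname{Kelly}(n,d)$,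 the poset $\operatorname{Kelly}(n,d+1)$ is obtained from $K_n$ as follows: for each $i=1,\dots,n$, take a copy of $\operatorname{Kelly}(n,d)$, relabel each of its elements $(x_1,\dots,x_k)$ as $(a_i,x_1,\dots,x_k)$, and identify the element $(a_i,b_n)$ of this copy with the element $a_i$ of $K_n$ (the identified element is named $(a_i,b_n)$). The order of $\operatorname{Kelly}(n,d+1)$ is the transitive closure of the union of the order of $K_n$ and the orders of the $n$ copies. (All these posets are planar.) -}

module Defs where

open import Data.Nat using (ℕ; zero; suc; _≤_)
open import Data.Fin using (Fin; toℕ; inject₁; fromℕ) renaming (_<_ to _<ᶠ_)
import Data.Fin.Properties as FinP
open import Data.Empty using (⊥)
open import Data.List using (List; length; filter; lookup)
open import Data.List.Relation.Unary.Any using (Any; any?)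
open import Data.List.Relation.Unary.Unique.Propositional using (Unique)
open import Data.Product using (Σ; _×_; _,_; ∃)
open import Relation.Nullary using (¬_; Dec; yes; no)
open import Relation.Binary using (Rel; DecidableEquality)
open import Relation.Binary.PropositionalEquality using (_≡_; _≢_; refl; cong; cong₂)
open import Relation.Binary.Construct.Closure.Transitive using (TransClosure)
open import Level using (0ℓ)

-- Generic (finite) posets given by their strict order, with decidable
-- equality on the carrier (needed to count memberships).

record FinPoset : Set₁ where
  field
    Carrier : Set
    _≟_     : DecidableEquality Carrier
    _<_     : Rel Carrier 0ℓ

module _ (P : FinPoset) where
  open FinPoset P

  Incomparable : Carrier → Carrier → Set
  Incomparable x y = x ≢ y × ¬ (x < y) × ¬ (y < x)

  -- A partial linear extension: a list of distinct elements of P (the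
  -- linear order is the list order) extending P restricted to them.
  record PLE : Set where
    field
      elems    : List Carrier
      distinct : Unique elems
      extends  : ∀ (i j : Fin (length elems)) → i <ᶠ j →
                 ¬ (lookup elems j < lookup elems i)

  Before : PLE → Carrier → Carrier → Set
  Before L x y = Σ (Fin (length (PLE.elems L))) λ i → Σ (Fin (length (PLE.elems L))) λ j →
    i <ᶠ j × lookup (PLE.elems L) i ≡ x × lookup (PLE.elems L) j ≡ y

  μ : Carrier → List PLE → ℕ
  μ u 𝓛 = length (filter (λ L → any? (u ≟_) (PLE.elems L)) 𝓛)

  MuIs : List PLE → ℕ → Set
  MuIs 𝓛 k = (∀ u → μ u 𝓛 ≤ k) × ∃ λ u → μ u 𝓛 ≡ k

  IsLocalRealizer : List PLE → Set
  IsLocalRealizer 𝓛 =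
    (∀ x y → x < y → Any (λ L → Before L x y) 𝓛) ×
    (∀ x y → Incomparable x y → Any (λ L → Before L y x) 𝓛)

  LdimIs : ℕ → Set
  LdimIs k = 1 ≤ k × (∃ λ 𝓛 → IsLocalRealizer 𝓛 × MuIs 𝓛 k) ×
    (∀ k' (𝓛 : List PLE) → 1 ≤ k' → IsLocalRealizer 𝓛 → MuIs 𝓛 k' → k ≤ k')

  LdimAtLeast : ℕ → Set
  LdimAtLeast d = ∃ λ k → LdimIs k × d ≤ k

-- Kelly construction K_n with n = suc m (indices 0-based):
-- a_i, b_i : Fin n ;  w_i, z_i : Fin (n-1) = Fin m.

data NA (m : ℕ) : Set where
  b : Fin (suc m) → NA m
  w : Fin m → NA m
  z : Fin m → NA m

data KE (m : ℕ) : Set where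
  a  : Fin (suc m) → KE m
  na : NA m → KE m

data KGen {m : ℕ} : KE m → KE m → Set where
  aw : (i : Fin m) → KGen (a (inject₁ i)) (na (w i))
  wb : (i : Fin m) → KGen (na (w i)) (na (b (Fin.suc i)))
  az : (i : Fin m) → KGen (a (Fin.suc i)) (na (z i))
  zb : (i : Fin m) → KGen (na (z i)) (na (b (inject₁ i)))
  ww : (i j : Fin m) → toℕ j ≡ suc (toℕ i) → KGen (na (w i)) (na (w j))
  zz : (i j : Fin m) → toℕ j ≡ suc (toℕ i) → KGen (na (z j)) (na (z i))

-- Kelly(n, d) with n = suc m, d = suc e.
-- Elt m 0        = elements of K_n
-- Elt m (suc e)  = top-level non-a elements of K_n, plus copies
--                  sub i x  (= the sequence (a_i, x…)) of Kelly(n, e+1);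
-- a_i of K_n is identified with sub i (bTop e) = (a_i, b_n).

data Elt (m : ℕ) : ℕ → Set where
  leaf : KE m → Elt m zero
  top  : ∀ {e} → NA m → Elt m (suc e)
  sub  : ∀ {e} → Fin (suc m) → Elt m e → Elt m (suc e)

bTop : ∀ {m} e → Elt m e
bTop {m} zero    = leaf (na (b (fromℕ m)))
bTop {m} (suc e) = top (b (fromℕ m))

emb : ∀ {m} e → KE m → Elt m (suc e)
emb e (a i)  = sub i (bTop e)
emb e (na x) = top x

data Gen {m : ℕ} : ∀ {e} → Elt m e → Elt m e → Set where
  base : ∀ {x y} → KGen x y → Gen (leaf x) (leaf y)
  kel  : ∀ {e x y} → KGen x y → Gen (emb e x) (emb e y)
  lift : ∀ {e x y} (i : Fin (suc m)) → Gen {e = e} x y → Gen (sub i x) (sub i y)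

KLt : ∀ {m e} → Rel (Elt m e) 0ℓ
KLt = TransClosure Gen

_≟NA_ : ∀ {m} → DecidableEquality (NA m)
b i ≟NA b j with i FinP.≟ j
... | yes refl = yes refl
... | no ne = no λ { refl → ne refl }
w i ≟NA w j with i FinP.≟ j
... | yes refl = yes refl
... | no ne = no λ { refl → ne refl }
z i ≟NA z j with i FinP.≟ j
... | yes refl = yes refl
... | no ne = no λ { refl → ne refl }
b _ ≟NA w _ = no λ ()
b _ ≟NA z _ = no λ ()
w _ ≟NA b _ = no λ ()
w _ ≟NA z _ = no λ ()
z _ ≟NA b _ = no λ ()
z _ ≟NA w _ = no λ ()

_≟KE_ : ∀ {m} → DecidableEquality (KE m)
a i ≟KE a j with i FinP.≟ j
... | yes refl = yes refl
... | no ne = no λ { refl → ne refl }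
na x ≟KE na y with x ≟NA y
... | yes refl = yes refl
... | no ne = no λ { refl → ne refl }
a _ ≟KE na _ = no λ ()
na _ ≟KE a _ = no λ ()

_≟E_ : ∀ {m e} → DecidableEquality (Elt m e)
leaf x ≟E leaf y with x ≟KE y
... | yes refl = yes refl
... | no ne = no λ { refl → ne refl }
top x ≟E top y with x ≟NA y
... | yes refl = yes refl
... | no ne = no λ { refl → ne refl }
sub i x ≟E sub j y with i FinP.≟ j | x ≟E y
... | yes refl | yes refl = yes refl
... | no ne | _ = no λ { refl → ne refl }
... | yes _ | no ne = no λ { refl → ne refl }
top _ ≟E sub _ _ = no λ ()
sub _ _ ≟E top _ = no λ ()

emptyPoset : FinPoset
emptyPoset = record { Carrier = ⊥ ; _≟_ = λ () ; _<_ = λ _ _ → ⊥ }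

-- Kelly(n, d); only meaningful for n ≥ 2, d ≥ 1 (other values: dummy).
Kelly : ℕ → ℕ → FinPoset
Kelly (suc m) (suc e) = record { Carrier = Elt m e ; _≟_ = _≟E_ ; _<_ = KLt }
Kelly _ _ = emptyPoset

{-# OPTIONS --safe #-}
-- The lower bound uses only the elements x = (a_{i₁}, …, a_{i_d}) with no index equal
-- to n.  Such an x lies below every b_{i₁…i_{k-1} j} with j ≠ i_k, but must be reversed
-- with each of the d elements b_{i₁…i_k}.  A single ple cannot reverse such pairs for two
-- different values of i_k below one prefix, so if every element lies in at most d - 1
-- ple's, then for large n each i_k can be chosen in turn so that none of the boundedly
-- many ple's containing an earlier b_{i₁…i_l} reverses x with b_{i₁…i_k}.  The d reversals
-- then take place in different ple's.
-- Leastness of n_d requires deciding ldim ≥ d for the finitely many smaller n.  Only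
-- finitely many families need to be searched: after discarding empty lists, a family with
-- μ ≤ k on N elements has at most N k members.
module Submission where

open import Defs
open import Data.Nat using (ℕ; zero; suc; _+_; _*_; _∸_; _≤_; _<_; z≤n; s≤s; _≤?_; _<?_)
open import Data.Nat.Properties
open import Data.Nat.ListAction using (sum)
open import Data.Fin using (Fin; toℕ; inject₁; fromℕ<)
  renaming (zero to fzero; suc to fsuc; _<_ to _<ᶠ_)
import Data.Fin.Properties as FinP
open import Data.Fin.Relation.Unary.Top using (view; ‵fromℕ; ‵inject₁)
open import Data.Empty using (⊥)
open import Data.List using (List; []; _∷_; _++_; length; lookup; map; mapMaybe;
  cartesianProductWith; filter; allFin)
open import Data.List.Properties using (filter-accept; filter-reject; filter-some; length-++)
open import Data.List.Membership.Propositional using (_∈_; find; lose)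
open import Data.List.Membership.Propositional.Properties using (∈-lookup; ∈-++⁺ˡ; ∈-++⁺ʳ;
  ∈-map⁺; ∈-allFin; ∈-filter⁺; ∈-cartesianProductWith⁺)
open import Data.List.Relation.Unary.Any as Any using (Any; here; there; any?)
import Data.List.Relation.Unary.Any.Properties as AnyP
open import Data.List.Relation.Unary.All as All using (All; []; _∷_; all?)
open import Data.List.Relation.Unary.All.Properties using (¬All⇒Any¬; All¬⇒¬Any)
open import Data.List.Relation.Unary.AllPairs using ([]; _∷_)
open import Data.List.Relation.Unary.Unique.Propositional using (Unique)
import Data.List.Relation.Unary.Unique.DecPropositional as DecUnique
import Data.Maybe as Maybe
import Data.Maybe.Relation.Unary.Any as MAny
open import Data.Product using (Σ; ∃; _×_; _,_; proj₁; proj₂)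
open import Data.Sum using (_⊎_; inj₁; inj₂; [_,_]′)
open import Function using (_∘_; id)
open import Level using (0ℓ)
open import Relation.Nullary using (¬_; Dec; yes; no; contradiction)
open import Relation.Nullary.Decidable
  using (map′; _×-dec_; _⊎-dec_; _→-dec_; ¬?; dec⇒maybe; decidable-stable)
open import Relation.Binary using (Rel; Transitive; Decidable; tri<; tri≈; tri>)
open import Relation.Binary.Construct.Closure.Transitive using (TransClosure; [_]; _∷_)
  renaming (_++_ to _++⁺_)
open import Relation.Binary.PropositionalEquality
  using (_≡_; _≢_; refl; sym; trans; cong; subst)
import Relation.Unary as U

-- The order of Kelly(n, d)

infix 4 _<ᴷ_ _<ᴱ_ _<ᴸ?_

-- Explicit form of the transitive closure of `KGen`. A closure cannot be decided by inspection,
-- whereas here every case is a comparison of indices.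
_<ᴷ_ : ∀ {m} → KE m → KE m → Set
a i      <ᴷ na (b j) = i ≢ j
a i      <ᴷ na (w k) = toℕ i ≤ toℕ k
a i      <ᴷ na (z k) = toℕ k < toℕ i
na (w i) <ᴷ na (b j) = toℕ i < toℕ j
na (w i) <ᴷ na (w j) = toℕ i < toℕ j
na (z i) <ᴷ na (b j) = toℕ j ≤ toℕ i
na (z i) <ᴷ na (z j) = toℕ j < toℕ i
_        <ᴷ _        = ⊥

<ᴷ-irrefl : ∀ {m} (x : KE m) → ¬ (x <ᴷ x)
<ᴷ-irrefl (na (w i)) = <-irrefl refl
<ᴷ-irrefl (na (z i)) = <-irrefl refl

<ᴷ? : ∀ {m} → Decidable (_<ᴷ_ {m})
<ᴷ? (a _)      (a _)      = no λ ()
<ᴷ? (a i)      (na (b j)) = ¬? (i FinP.≟ j)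
<ᴷ? (a i)      (na (w k)) = toℕ i ≤? toℕ k
<ᴷ? (a i)      (na (z k)) = toℕ k <? toℕ i
<ᴷ? (na (b _)) (a _)      = no λ ()
<ᴷ? (na (b _)) (na _)     = no λ ()
<ᴷ? (na (w _)) (a _)      = no λ ()
<ᴷ? (na (w i)) (na (b j)) = toℕ i <? toℕ j
<ᴷ? (na (w i)) (na (w j)) = toℕ i <? toℕ j
<ᴷ? (na (w _)) (na (z _)) = no λ ()
<ᴷ? (na (z _)) (a _)      = no λ ()
<ᴷ? (na (z i)) (na (b j)) = toℕ j ≤? toℕ i
<ᴷ? (na (z _)) (na (w _)) = no λ ()
<ᴷ? (na (z i)) (na (z j)) = toℕ j <? toℕ i

KGen⇒<ᴷ : ∀ {m} {x y : KE m} → KGen x y → x <ᴷ y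
KGen⇒<ᴷ (aw i)      = ≤-reflexive (FinP.toℕ-inject₁ i)
KGen⇒<ᴷ (wb i)      = ≤-refl
KGen⇒<ᴷ (az i)      = ≤-refl
KGen⇒<ᴷ (zb i)      = ≤-reflexive (FinP.toℕ-inject₁ i)
KGen⇒<ᴷ (ww i j eq) = ≤-reflexive (sym eq)
KGen⇒<ᴷ (zz i j eq) = ≤-reflexive (sym eq)

-- A `TransClosure` path is consumed one generator at a time from its lower end, so prefixing a
-- generator is the form of transitivity that the induction uses.
KGen-<ᴷ-trans : ∀ {m} {x y : KE m} v → KGen x y → y <ᴷ v → x <ᴷ v
KGen-<ᴷ-trans (na (b j)) (aw i) i<j refl =
  <-irrefl (sym (FinP.toℕ-inject₁ i)) i<j
KGen-<ᴷ-trans (na (w j)) (aw i) i<j =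
  ≤-trans (≤-reflexive (FinP.toℕ-inject₁ i)) (<⇒≤ i<j)
KGen-<ᴷ-trans (na (b j)) (az i) j≤i refl = <-irrefl refl j≤i
KGen-<ᴷ-trans (na (z j)) (az i) j<i = m≤n⇒m≤1+n j<i
KGen-<ᴷ-trans (na (b k)) (ww i j eq) j<k = <-trans (≤-reflexive (sym eq)) j<k
KGen-<ᴷ-trans (na (w k)) (ww i j eq) j<k = <-trans (≤-reflexive (sym eq)) j<k
KGen-<ᴷ-trans (na (b k)) (zz i j eq) k≤i =
  ≤-trans k≤i (<⇒≤ (≤-reflexive (sym eq)))
KGen-<ᴷ-trans (na (z k)) (zz i j eq) k<i = <-trans k<i (≤-reflexive (sym eq))

-- Induction on the gap between the indices, raising the lower end. `S` is abstract so that the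
-- ascending w's and the descending z's share the argument.
consecutive⇒< : ∀ {m} (S : Rel (Fin m) 0ℓ) → Transitive S →
  (∀ i j → toℕ j ≡ suc (toℕ i) → S i j) → ∀ {i j} → toℕ i < toℕ j → S i j
consecutive⇒< {m} S S-trans step {i} {j} i<j =
  go (toℕ j ∸ suc (toℕ i)) i (sym (m∸n+n≡m i<j))
  where
  go : ∀ k i → toℕ j ≡ k + suc (toℕ i) → S i j
  go zero    i eq = step i j eq
  go (suc k) i eq = S-trans (step i i⁺ i⁺≡) (go k i⁺ (trans eq (trans
      (sym (+-suc k _)) (cong (λ t → k + suc t) (sym i⁺≡)))))
    where
    i⁺<m : suc (toℕ i) < m
    i⁺<m = ≤-<-trans (≤-trans (m≤n+m _ (suc k)) (≤-reflexive (sym eq))) (FinP.toℕ<n j)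
    i⁺ = fromℕ< i⁺<m
    i⁺≡ : toℕ i⁺ ≡ suc (toℕ i)
    i⁺≡ = FinP.toℕ-fromℕ< i⁺<m

private
  w-chain : ∀ {m} {i j : Fin m} → toℕ i < toℕ j → TransClosure KGen (na (w i)) (na (w j))
  w-chain = consecutive⇒< _ _++⁺_ λ i j eq → [ ww i j eq ]

  z-chain : ∀ {m} {i j : Fin m} → toℕ i < toℕ j → TransClosure KGen (na (z j)) (na (z i))
  z-chain = consecutive⇒< (λ i j → TransClosure KGen (na (z j)) (na (z i)))
    (λ p q → q ++⁺ p) λ i j eq → [ zz i j eq ]

  w<b : ∀ {m} (i : Fin m) j → toℕ i < toℕ j → TransClosure KGen (na (w i)) (na (b j))
  w<b i (fsuc j) (s≤s i≤j) with m≤n⇒m<n∨m≡n i≤j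
  ... | inj₁ i<j = w-chain i<j ++⁺ [ wb j ]
  ... | inj₂ i≡j with refl ← FinP.toℕ-injective i≡j = [ wb i ]

private
  z<b : ∀ {m} (i : Fin m) j → toℕ j ≤ toℕ i → TransClosure KGen (na (z i)) (na (b j))
  z<b i j j≤i with view j
  -- The last index is `m`, which exceeds every index of a `z`.
  ... | ‵fromℕ = contradiction (subst (_≤ toℕ i) (FinP.toℕ-fromℕ _) j≤i) (<⇒≱ (FinP.toℕ<n i))
  ... | ‵inject₁ k with m≤n⇒m<n∨m≡n (subst (_≤ toℕ i) (FinP.toℕ-inject₁ k) j≤i)
  ...   | inj₁ k<i = z-chain k<i ++⁺ [ zb k ]
  ...   | inj₂ k≡i with refl ← FinP.toℕ-injective k≡i = [ zb i ]

  a<w : ∀ {m} i (k : Fin m) → toℕ i ≤ toℕ k → TransClosure KGen (a i) (na (w k))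
  a<w i k i≤k with view i
  ... | ‵fromℕ = contradiction (subst (_≤ toℕ k) (FinP.toℕ-fromℕ _) i≤k) (<⇒≱ (FinP.toℕ<n k))
  ... | ‵inject₁ j with m≤n⇒m<n∨m≡n (subst (_≤ toℕ k) (FinP.toℕ-inject₁ j) i≤k)
  ...   | inj₁ j<k = aw j ∷ w-chain j<k
  ...   | inj₂ j≡k with refl ← FinP.toℕ-injective j≡k = [ aw j ]

  a<z : ∀ {m} i (k : Fin m) → toℕ k < toℕ i → TransClosure KGen (a i) (na (z k))
  a<z (fsuc i) k (s≤s k≤i) with m≤n⇒m<n∨m≡n k≤i
  ... | inj₁ k<i = az i ∷ z-chain k<i
  ... | inj₂ k≡i with refl ← FinP.toℕ-injective k≡i = [ az i ]

  -- The w's lead from `a i` to the b's of larger index, the z's to those of smaller index.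
  a<b : ∀ {m} (i j : Fin (suc m)) → i ≢ j → TransClosure KGen (a i) (na (b j))
  a<b i j i≢j with FinP.<-cmp i j
  a<b i (fsuc j) i≢j | tri< (s≤s i≤j) _ _ = a<w i j i≤j ++⁺ [ wb j ]
  a<b i j        i≢j | tri≈ _ i≡j _ = contradiction i≡j i≢j
  a<b (fsuc i) j i≢j | tri> _ _ (s≤s j≤i) = az i ∷ z<b i j j≤i

<ᴷ⇒KGen⁺ : ∀ {m} (x y : KE m) → x <ᴷ y → TransClosure KGen x y
<ᴷ⇒KGen⁺ (a i)      (na (b j)) = a<b i j
<ᴷ⇒KGen⁺ (a i)      (na (w k)) = a<w i k
<ᴷ⇒KGen⁺ (a i)      (na (z k)) = a<z i k
<ᴷ⇒KGen⁺ (na (w i)) (na (b j)) = w<b i j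
<ᴷ⇒KGen⁺ (na (w i)) (na (w j)) = w-chain
<ᴷ⇒KGen⁺ (na (z i)) (na (b j)) = z<b i j
<ᴷ⇒KGen⁺ (na (z i)) (na (z j)) = z-chain

-- An element of copy i reaches a top-level element only through (a_i, b_n) = a_i.
_<ᴱ_ : ∀ {m e} → Elt m e → Elt m e → Set
leaf x  <ᴱ leaf y  = x <ᴷ y
top x   <ᴱ top y   = na x <ᴷ na y
top x   <ᴱ sub _ _ = ⊥
sub i x <ᴱ top y   = (x ≡ bTop _ ⊎ x <ᴱ bTop _) × a i <ᴷ na y
sub i x <ᴱ sub j y = i ≡ j × x <ᴱ y

<ᴱ-irrefl : ∀ {m e} (x : Elt m e) → ¬ (x <ᴱ x)
<ᴱ-irrefl (leaf x)  = <ᴷ-irrefl x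
<ᴱ-irrefl (top x)   = <ᴷ-irrefl (na x)
<ᴱ-irrefl (sub i x) = <ᴱ-irrefl x ∘ proj₂

<ᴱ? : ∀ {m e} → Decidable (_<ᴱ_ {m} {e})
<ᴱ? (leaf x)  (leaf y)  = <ᴷ? x y
<ᴱ? (top x)   (top y)   = <ᴷ? (na x) (na y)
<ᴱ? (top _)   (sub _ _) = no λ ()
<ᴱ? (sub i x) (top y)   = (x ≟E bTop _ ⊎-dec <ᴱ? x (bTop _)) ×-dec <ᴷ? (a i) (na y)
<ᴱ? (sub i x) (sub j y) = i FinP.≟ j ×-dec <ᴱ? x y

Gen⇒<ᴱ : ∀ {m e} {x y : Elt m e} → Gen x y → x <ᴱ y
Gen⇒<ᴱ (base g) = KGen⇒<ᴷ g
Gen⇒<ᴱ (kel {x = a i}  {y = na y} g) = inj₁ refl , KGen⇒<ᴷ g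
Gen⇒<ᴱ (kel {x = na x} {y = na y} g) = KGen⇒<ᴷ g
Gen⇒<ᴱ (kel {x = a i}  {y = a j} ())
Gen⇒<ᴱ (kel {x = na x} {y = a j} ())
Gen⇒<ᴱ (lift i g) = refl , Gen⇒<ᴱ g

-- No generator of `K_n` ends in an `a`, so the target of a `kel` step is always a top-level
-- element.
Gen-<ᴱ-trans : ∀ {m e} {x y : Elt m e} v → Gen x y → y <ᴱ v → x <ᴱ v
Gen-<ᴱ-trans (leaf v) (base g) q = KGen-<ᴷ-trans v g q
Gen-<ᴱ-trans (top v) (kel {x = a i}  {y = na y} g) q = inj₁ refl , KGen-<ᴷ-trans (na v) g q
Gen-<ᴱ-trans (top v) (kel {x = na x} {y = na y} g) q = KGen-<ᴷ-trans (na v) g q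
Gen-<ᴱ-trans v (kel {x = a i}  {y = a j} ())
Gen-<ᴱ-trans v (kel {x = na x} {y = a j} ())
-- A lifted generator ending at the gluing point turns equality with that point into strict
-- inequality.
Gen-<ᴱ-trans (top v) (lift i g) (inj₁ refl , q) = inj₂ (Gen⇒<ᴱ g) , q
Gen-<ᴱ-trans (top v) (lift i g) (inj₂ p , q) = inj₂ (Gen-<ᴱ-trans _ g p) , q
Gen-<ᴱ-trans (sub j v) (lift i g) (refl , p) = refl , Gen-<ᴱ-trans v g p

KLt⇒<ᴱ : ∀ {m e} {x y : Elt m e} → KLt x y → x <ᴱ y
KLt⇒<ᴱ [ g ]   = Gen⇒<ᴱ g
KLt⇒<ᴱ (g ∷ p) = Gen-<ᴱ-trans _ g (KLt⇒<ᴱ p)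

map⁺ : ∀ {A B : Set} {R : Rel A 0ℓ} {S : Rel B 0ℓ} (f : A → B) →
  (∀ {x y} → R x y → S (f x) (f y)) →
  ∀ {x y} → TransClosure R x y → TransClosure S (f x) (f y)
map⁺ f h [ g ]   = [ h g ]
map⁺ f h (g ∷ p) = h g ∷ map⁺ f h p

sub-mono : ∀ {m e} (i : Fin (suc m)) {x y : Elt m e} → KLt x y → KLt (sub i x) (sub i y)
sub-mono i = map⁺ (sub i) (lift i)

emb-mono : ∀ {m} e (x y : KE m) → x <ᴷ y → KLt (emb e x) (emb e y)
emb-mono e x y p = map⁺ (emb e) kel (<ᴷ⇒KGen⁺ x y p)

<ᴱ⇒KLt : ∀ {m e} (x y : Elt m e) → x <ᴱ y → KLt x y
<ᴱ⇒KLt (leaf x) (leaf y) p = map⁺ leaf base (<ᴷ⇒KGen⁺ x y p)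
<ᴱ⇒KLt (top x) (top y) p = emb-mono _ (na x) (na y) p
<ᴱ⇒KLt (sub i x) (top y) (inj₁ refl , p) = emb-mono _ (a i) (na y) p
<ᴱ⇒KLt (sub i x) (top y) (inj₂ q , p) =
  -- `sub i (bTop e)` is `emb e (a i)` by definition, so the path inside the copy continues in
  -- `K_n`.
  sub-mono i (<ᴱ⇒KLt x _ q) ++⁺ emb-mono _ (a i) (na y) p
<ᴱ⇒KLt (sub i x) (sub j y) (refl , p) = sub-mono i (<ᴱ⇒KLt x y p)

KLt-irrefl : ∀ {m e} {x : Elt m e} → ¬ KLt x x
KLt-irrefl {x = x} = <ᴱ-irrefl x ∘ KLt⇒<ᴱ

_<ᴸ?_ : ∀ {m e} → Decidable (KLt {m} {e})
x <ᴸ? y = map′ (<ᴱ⇒KLt x y) KLt⇒<ᴱ (<ᴱ? x y)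

-- Deciding the local dimension of a finite poset

listsUpTo : ∀ {a} {A : Set a} → List A → ℕ → List (List A)
listsUpTo xs zero    = [] ∷ []
listsUpTo xs (suc n) = [] ∷ cartesianProductWith _∷_ xs (listsUpTo xs n)

∈-listsUpTo : ∀ {a} {A : Set a} {xs : List A} n {ys} →
  All (_∈ xs) ys → length ys ≤ n → ys ∈ listsUpTo xs n
∈-listsUpTo zero    []          _       = here refl
∈-listsUpTo (suc n) []          _       = here refl
∈-listsUpTo (suc n) (y∈ ∷ ys∈) (s≤s l) =
  there (∈-cartesianProductWith⁺ _∷_ y∈ (∈-listsUpTo n ys∈ l))

Unique⇒lookup-injective : ∀ {A : Set} {xs : List A} → Unique xs →
  ∀ {i j} → lookup xs i ≡ lookup xs j → i ≡ j
Unique⇒lookup-injective (_ ∷ _) {fzero}  {fzero}  _  = refl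
Unique⇒lookup-injective (x∉ ∷ _) {fzero} {fsuc j} eq =
  contradiction eq (All.lookup x∉ (∈-lookup j))
Unique⇒lookup-injective (x∉ ∷ _) {fsuc i} {fzero} eq =
  contradiction (sym eq) (All.lookup x∉ (∈-lookup i))
Unique⇒lookup-injective (_ ∷ u) {fsuc i} {fsuc j} eq =
  cong fsuc (Unique⇒lookup-injective u eq)

-- Pigeonhole on positions. It bounds the length of a ple by the number of elements, which makes the
-- ple's enumerable.
Unique⇒length≤ : ∀ {A : Set} {xs ys : List A} → Unique xs → (∀ x → x ∈ ys) →
  length xs ≤ length ys
Unique⇒length≤ {xs = xs} {ys} u ∈ys = FinP.injective⇒≤ {f = position} λ {i} {j} eq →
  Unique⇒lookup-injective u (trans (AnyP.lookup-index (∈ys (lookup xs i)))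
    (trans (cong (lookup ys) eq) (sym (AnyP.lookup-index (∈ys (lookup xs j))))))
  where
  position : Fin (length xs) → Fin (length ys)
  position i = Any.index (∈ys (lookup xs i))

sum-map-≤ : ∀ {A : Set} (f : A → ℕ) {k} → (∀ x → f x ≤ k) →
  ∀ xs → sum (map f xs) ≤ length xs * k
sum-map-≤ f f≤k []       = z≤n
sum-map-≤ f f≤k (x ∷ xs) = +-mono-≤ (f≤k x) (sum-map-≤ f f≤k xs)

sum-map-mono : ∀ {A : Set} {f g : A → ℕ} → (∀ x → f x ≤ g x) →
  ∀ xs → sum (map f xs) ≤ sum (map g xs)
sum-map-mono f≤g []       = z≤n
sum-map-mono f≤g (x ∷ xs) = +-mono-≤ (f≤g x) (sum-map-mono f≤g xs)

sum-map-mono-< : ∀ {A : Set} {f g : A → ℕ} → (∀ x → f x ≤ g x) →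
  ∀ {xs} → Any (λ x → f x < g x) xs → sum (map f xs) < sum (map g xs)
sum-map-mono-< f≤g {_ ∷ xs} (here f<g) = +-mono-<-≤ f<g (sum-map-mono f≤g xs)
sum-map-mono-< f≤g {x ∷ _}  (there p)   = +-mono-≤-< (f≤g x) (sum-map-mono-< f≤g p)

least : ∀ {P : ℕ → Set} → U.Decidable P → ∀ n → P n →
  ∃ λ k → P k × (∀ j → j < k → ¬ P j)
least P? zero p = zero , p , λ _ ()
least {P} P? (suc n) p with P? zero
... | yes p₀ = zero , p₀ , λ _ ()
... | no ¬p₀ with k , pk , min ← least (P? ∘ suc) n p =
  suc k , pk , λ { zero _ → ¬p₀ ; (suc j) (s≤s j<k) → min j j<k }

maximum : ∀ {A : Set} (f : A → ℕ) x xs → ∃ λ y → ∀ {z} → z ∈ x ∷ xs → f z ≤ f y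
maximum f x [] = x , λ { (here refl) → ≤-refl }
maximum f x (x′ ∷ xs) with y , max ← maximum f x′ xs with ≤-total (f x) (f y)
... | inj₁ fx≤ = y , λ { (here refl) → fx≤ ; (there p) → max p }
... | inj₂ ≤fx = x , λ { (here refl) → ≤-refl ; (there p) → ≤-trans (max p) ≤fx }

-- `FinPoset` carries neither an enumeration nor the order axioms; this supplies what the search for
-- realizers uses.
record FiniteDec (P : FinPoset) : Set where
  open FinPoset P renaming (_<_ to _≺_)
  field
    elements : List Carrier
    complete : ∀ x → x ∈ elements
    _≺?_     : Decidable _≺_
    irrefl   : ∀ {x} → ¬ (x ≺ x)
    ≺-trans  : Transitive _≺_

-- Families of ple's with bounded multiplicity

module LocalRealizer (P : FinPoset) where
  open FinPoset P renaming (_<_ to _≺_; _≟_ to _≟ᶜ_)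

  Extends : List Carrier → Set
  Extends xs = ∀ (i j : Fin (length xs)) → i <ᶠ j → ¬ (lookup xs j ≺ lookup xs i)

  _∈?_ : ∀ x xs → Dec (x ∈ xs)
  x ∈? xs = any? (x ≟ᶜ_) xs

  Before? : ∀ L x y → Dec (Before P L x y)
  Before? L x y = FinP.any? λ i → FinP.any? λ j → i FinP.<? j ×-dec
    (lookup (PLE.elems L) i ≟ᶜ x ×-dec lookup (PLE.elems L) j ≟ᶜ y)

  Before⇒∈ˡ : ∀ {L x y} → Before P L x y → x ∈ PLE.elems L
  Before⇒∈ˡ (i , _ , _ , refl , _) = ∈-lookup i

  Before⇒∈ʳ : ∀ {L x y} → Before P L x y → y ∈ PLE.elems L
  Before⇒∈ʳ (_ , j , _ , _ , refl) = ∈-lookup j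

  μ-∈ : ∀ {u} L 𝓛 → u ∈ PLE.elems L → μ P u (L ∷ 𝓛) ≡ suc (μ P u 𝓛)
  μ-∈ L 𝓛 u∈L = cong length (filter-accept (λ L → _ ∈? PLE.elems L) u∈L)

  μ-∉ : ∀ {u} L 𝓛 → ¬ u ∈ PLE.elems L → μ P u (L ∷ 𝓛) ≡ μ P u 𝓛
  μ-∉ L 𝓛 u∉L = cong length (filter-reject (λ L → _ ∈? PLE.elems L) u∉L)

  μ-tail : ∀ u L 𝓛 → μ P u 𝓛 ≤ μ P u (L ∷ 𝓛)
  μ-tail u L 𝓛 with u ∈? PLE.elems L
  ... | yes _ = n≤1+n _
  ... | no  _ = ≤-refl

  μ-cons-mono : ∀ {u} L L′ {𝓛 𝓛′} → (u ∈ PLE.elems L → u ∈ PLE.elems L′) →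
    μ P u 𝓛 ≤ μ P u 𝓛′ → μ P u (L ∷ 𝓛) ≤ μ P u (L′ ∷ 𝓛′)
  μ-cons-mono {u} L L′ {𝓛} {𝓛′} L⊆L′ le with u ∈? PLE.elems L
  ... | yes u∈L = subst (suc (μ P u 𝓛) ≤_) (sym (μ-∈ L′ 𝓛′ (L⊆L′ u∈L))) (s≤s le)
  ... | no  _   = ≤-trans le (μ-tail u L′ 𝓛′)

  -- An upper bound replaces the exact maximum of `μ`, so the property is monotone in `k`; in a
  -- poset with a comparable pair, the local dimension is the least such `k`.
  HasRealizer : ℕ → Set
  HasRealizer k = ∃ λ 𝓛 → IsLocalRealizer P 𝓛 × ∀ u → μ P u 𝓛 ≤ k

module Decide (P : FinPoset) (fin : FiniteDec P) where
  open FinPoset P renaming (_<_ to _≺_; _≟_ to _≟ᶜ_)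
  open FiniteDec fin
  open LocalRealizer P

  ∃? : ∀ {Q : Carrier → Set} → U.Decidable Q → Dec (∃ Q)
  ∃? Q? = map′ Any.satisfied (λ (x , q) → lose (complete x) q) (any? Q? elements)

  ∀? : ∀ {Q : Carrier → Set} → U.Decidable Q → Dec (∀ x → Q x)
  ∀? Q? = map′ (λ all x → All.lookup all (complete x)) (λ q → All.tabulate λ {x} _ → q x)
    (all? Q? elements)

  toPLE? : ∀ xs → Dec (Unique xs × Extends xs)
  toPLE? xs = DecUnique.unique? _≟ᶜ_ xs ×-dec
    (FinP.all? λ i → FinP.all? λ j → i FinP.<? j →-dec ¬? (lookup xs j ≺? lookup xs i))

  mkPLE : ∀ xs → Unique xs × Extends xs → PLE P
  mkPLE xs (u , e) = record { elems = xs ; distinct = u ; extends = e }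

  toPLE : List Carrier → Maybe.Maybe (PLE P)
  toPLE xs = Maybe.map (mkPLE xs) (dec⇒maybe (toPLE? xs))

  allPLEs : List (PLE P)
  allPLEs = mapMaybe toPLE (listsUpTo elements (length elements))

  -- Agreement on `elems` is the right notion: `Before` and `μ` depend on nothing else, while the
  -- proof fields may differ.
  allPLEs-complete : ∀ (L : PLE P) → Any (λ L′ → PLE.elems L′ ≡ PLE.elems L) allPLEs
  allPLEs-complete L = AnyP.mapMaybe⁺ toPLE _ (AnyP.map⁺ (lose xs∈ toPLE-xs))
    where
    open PLE L renaming (elems to xs)
    xs∈ : xs ∈ listsUpTo elements (length elements)
    xs∈ = ∈-listsUpTo _ (All.tabulate λ {x} _ → complete x) (Unique⇒length≤ distinct complete)
    toPLE-xs : MAny.Any (λ L′ → PLE.elems L′ ≡ xs) (toPLE xs)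
    toPLE-xs with toPLE? xs
    ... | yes _ = MAny.just refl
    ... | no ¬p = contradiction (distinct , extends) ¬p

  NonEmpty : PLE P → Set
  NonEmpty L = ∃ (_∈ PLE.elems L)

  Before-resp : ∀ {L L′ : PLE P} → PLE.elems L′ ≡ PLE.elems L →
    ∀ {x y} → Before P L x y → Before P L′ x y
  Before-resp eq {x} {y} =
    subst (λ xs → Σ (Fin (length xs)) λ i → Σ (Fin (length xs)) λ j →
      i <ᶠ j × lookup xs i ≡ x × lookup xs j ≡ y) (sym eq)

  -- Empty ple's leave `μ` unchanged, so a bound on `μ` limits the size of a family only once they
  -- are dropped.
  record Normalised (𝓛 : List (PLE P)) : Set where
    field
      family   : List (PLE P)
      members  : All (_∈ allPLEs) family
      nonEmpty : All NonEmpty family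
      μ-≤      : ∀ u → μ P u family ≤ μ P u 𝓛
      before   : ∀ {x y} → Any (λ L → Before P L x y) 𝓛 → Any (λ L → Before P L x y) family

  normalise : ∀ 𝓛 → Normalised 𝓛
  normalise [] = record { family = [] ; members = [] ; nonEmpty = [] ; μ-≤ = λ _ → z≤n ; before = λ () }
  normalise (L ∷ 𝓛) with normalise 𝓛 | ∃? (_∈? PLE.elems L)
  ... | N | no empty = record
    { family = family ; members = members ; nonEmpty = nonEmpty
    ; μ-≤ = λ u → ≤-trans (μ-≤ u) (μ-tail u L 𝓛)
    ; before = λ { (here p) → contradiction (_ , Before⇒∈ˡ {L} p) empty ; (there p) → before p }
    }
    where open Normalised N
  ... | N | yes (v , v∈L) with L′ , L′∈ , eq ← find (allPLEs-complete L) = record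
    { family = L′ ∷ family ; members = L′∈ ∷ members
    ; nonEmpty = (v , subst (v ∈_) (sym eq) v∈L) ∷ nonEmpty
    ; μ-≤ = λ u → μ-cons-mono L′ L (subst (u ∈_) eq) (μ-≤ u)
    ; before = λ { (here p) → here (Before-resp {L} {L′} eq p) ; (there p) → there (before p) }
    }
    where open Normalised N

  -- Double counting of the incidences between elements and lists.
  length≤sum-μ : ∀ {𝓛} → All NonEmpty 𝓛 → length 𝓛 ≤ sum (map (λ u → μ P u 𝓛) elements)
  length≤sum-μ [] = z≤n
  length≤sum-μ {L ∷ 𝓛} ((v , v∈L) ∷ ne) = ≤-<-trans (length≤sum-μ ne)
    (sum-map-mono-< (λ u → μ-tail u L 𝓛) (lose (complete v) (≤-reflexive (sym (μ-∈ L 𝓛 v∈L)))))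

  incomparable? : Decidable (Incomparable P)
  incomparable? x y = ¬? (x ≟ᶜ y) ×-dec (¬? (x ≺? y) ×-dec ¬? (y ≺? x))

  isLocalRealizer? : U.Decidable (IsLocalRealizer P)
  isLocalRealizer? 𝓛 =
    (∀? λ x → ∀? λ y → x ≺? y →-dec any? (λ L → Before? L x y) 𝓛) ×-dec
    (∀? λ x → ∀? λ y → incomparable? x y →-dec any? (λ L → Before? L y x) 𝓛)

  -- The search is exhaustive because normalising any realizer within the bound yields one in the
  -- finite search space.
  hasRealizer? : U.Decidable HasRealizer
  hasRealizer? k = map′
    (λ p → let (𝓛 , _ , r) = find p in 𝓛 , r) small
    (any? (λ 𝓛 → isLocalRealizer? 𝓛 ×-dec ∀? λ u → μ P u 𝓛 ≤? k)
      (listsUpTo allPLEs (length elements * k)))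
    where
    small : HasRealizer k → Any _ (listsUpTo allPLEs (length elements * k))
    small (𝓛 , (cmp , inc) , μ≤k) = lose (∈-listsUpTo _ members length≤)
        (((λ x y → before ∘ cmp x y) , (λ x y → before ∘ inc x y)) , μ≤k′)
      where
      open Normalised (normalise 𝓛)
      μ≤k′ : ∀ u → μ P u family ≤ k
      μ≤k′ u = ≤-trans (μ-≤ u) (μ≤k u)
      length≤ : length family ≤ length elements * k
      length≤ = ≤-trans (length≤sum-μ nonEmpty) (sum-map-≤ _ μ≤k′ elements)

  pair : ∀ {x y} → x ≢ y → ¬ (y ≺ x) → PLE P
  pair {x} {y} x≢y y⊀x = record
    { elems    = x ∷ y ∷ []
    ; distinct = (x≢y ∷ []) ∷ [] ∷ []
    ; extends  = λ { fzero fzero () ; fzero (fsuc fzero) _ → y⊀x ; (fsuc fzero) fzero ()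
                   ; (fsuc fzero) (fsuc fzero) (s≤s ()) }
    }

  allPLEs-before : ∀ {x y} → x ≢ y → ¬ (y ≺ x) → Any (λ L → Before P L x y) allPLEs
  allPLEs-before x≢y y⊀x = Any.map
    (λ {L′} eq → Before-resp {pair x≢y y⊀x} {L′} eq (fzero , fsuc fzero , s≤s z≤n , refl , refl))
    (allPLEs-complete (pair x≢y y⊀x))

  -- Each required ordered pair is itself a two-element ple. This provides a realizer from which the
  -- search for the least `k` can start.
  allPLEs-isLocalRealizer : IsLocalRealizer P allPLEs
  allPLEs-isLocalRealizer =
    (λ x y x≺y → allPLEs-before (λ { refl → irrefl x≺y }) (irrefl ∘ ≺-trans x≺y)) ,
    (λ x y (x≢y , x⊀y , _) → allPLEs-before (x≢y ∘ sym) x⊀y)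

  max-μ : ∀ 𝓛 → Carrier → ∃ λ u → ∀ v → μ P v 𝓛 ≤ μ P u 𝓛
  max-μ 𝓛 x with u , max ← maximum (λ v → μ P v 𝓛) x elements = u , λ v → max (there (complete v))

  someRealizer : Carrier → ∃ HasRealizer
  someRealizer x with u , max ← max-μ allPLEs x = _ , allPLEs , allPLEs-isLocalRealizer , max

  HasRealizer⇒>0 : ∀ {k x y} → x ≺ y → HasRealizer k → 1 ≤ k
  HasRealizer⇒>0 {x = x} {y} x≺y (𝓛 , (cmp , _) , μ≤k) = ≤-trans
    (filter-some _ (Any.map (λ {L} → Before⇒∈ˡ {L}) (cmp x y x≺y))) (μ≤k x)

  ¬HasRealizer⇒LdimAtLeast : ∀ {e x y} → x ≺ y → ¬ HasRealizer e → LdimAtLeast P (suc e)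
  ¬HasRealizer⇒LdimAtLeast {e} {x} x≺y ¬r
    with K , R ← someRealizer x
    with k , (𝓛 , real , μ≤k) , min ← least hasRealizer? K R =
    k , (HasRealizer⇒>0 x≺y (𝓛 , real , μ≤k) , (𝓛 , real , μ≤k , attained) , minimal) ,
    ≰⇒> λ k≤e → ¬r (𝓛 , real , λ u → ≤-trans (μ≤k u) k≤e)
    where
    attained : ∃ λ u → μ P u 𝓛 ≡ k
    -- Were the maximum of `μ` below `k`, the same family would contradict the leastness of `k`.
    attained with u , max ← max-μ 𝓛 x = u , ≤-antisym (μ≤k u) (≮⇒≥ λ μ<k → min _ μ<k (𝓛 , real , max))
    minimal : ∀ k′ 𝓛′ → 1 ≤ k′ → IsLocalRealizer P 𝓛′ → MuIs P 𝓛′ k′ → k ≤ k′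
    minimal k′ 𝓛′ _ real′ (μ≤k′ , _) = ≮⇒≥ λ k′<k → min k′ k′<k (𝓛′ , real′ , μ≤k′)

  LdimAtLeast⇒¬HasRealizer : ∀ {e x y} → x ≺ y → LdimAtLeast P (suc e) → ¬ HasRealizer e
  LdimAtLeast⇒¬HasRealizer {x = x} x≺y (k , (_ , _ , minimal) , e<k) (𝓛 , real , μ≤e)
    -- `minimal` speaks of exact maxima, so it is applied to the maximum that `𝓛` attains, not to
    -- `e`.
    with u , max ← max-μ 𝓛 x = <⇒≱ e<k (≤-trans
      (minimal _ 𝓛 (HasRealizer⇒>0 x≺y (𝓛 , real , max)) real (max , u , refl)) (μ≤e u))

  ldimAtLeast? : ∀ {x y} → x ≺ y → ∀ e → Dec (LdimAtLeast P (suc e))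
  ldimAtLeast? x≺y e = map′ (¬HasRealizer⇒LdimAtLeast x≺y) (LdimAtLeast⇒¬HasRealizer x≺y)
    (¬? (hasRealizer? e))

-- The lower bound

allNA : ∀ m → List (NA m)
allNA m = map b (allFin (suc m)) ++ map w (allFin m) ++ map z (allFin m)

∈-allNA : ∀ {m} (x : NA m) → x ∈ allNA m
∈-allNA (b i) = ∈-++⁺ˡ (∈-map⁺ b (∈-allFin i))
∈-allNA {m} (w i) = ∈-++⁺ʳ (map b (allFin (suc m))) (∈-++⁺ˡ (∈-map⁺ w (∈-allFin i)))
∈-allNA {m} (z i) =
  ∈-++⁺ʳ (map b (allFin (suc m))) (∈-++⁺ʳ (map w (allFin m)) (∈-map⁺ z (∈-allFin i)))

allElt : ∀ m e → List (Elt m e)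
allElt m zero    = map (leaf ∘ a) (allFin (suc m)) ++ map (leaf ∘ na) (allNA m)
allElt m (suc e) = map top (allNA m) ++ cartesianProductWith sub (allFin (suc m)) (allElt m e)

∈-allElt : ∀ {m e} (x : Elt m e) → x ∈ allElt m e
∈-allElt (leaf (a i)) = ∈-++⁺ˡ (∈-map⁺ (leaf ∘ a) (∈-allFin i))
∈-allElt {m} (leaf (na x)) =
  ∈-++⁺ʳ (map (leaf ∘ a) (allFin (suc m))) (∈-map⁺ (leaf ∘ na) (∈-allNA x))
∈-allElt (top x) = ∈-++⁺ˡ (∈-map⁺ top (∈-allNA x))
∈-allElt {m} (sub i x) =
  ∈-++⁺ʳ (map top (allNA m)) (∈-cartesianProductWith⁺ sub (∈-allFin i) (∈-allElt x))

kellyFinite : ∀ m e → FiniteDec (Kelly (suc m) (suc e))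
kellyFinite m e = record
  { elements = allElt m e
  ; complete = ∈-allElt
  ; _≺?_     = _<ᴸ?_
  ; irrefl   = KLt-irrefl
  ; ≺-trans  = _++⁺_
  }

-- Pigeonhole: if every index were bad for some member of `xs`, the positions of these members would
-- inject `Fin m` into a shorter list.
avoid : ∀ {B : Set} {m} {Bad : Fin m → B → Set} → (∀ i x → Dec (Bad i x)) →
  (∀ {i j x} → Bad i x → Bad j x → i ≡ j) →
  ∀ xs → length xs < m → ∃ λ i → All (¬_ ∘ Bad i) xs
avoid {m = m} {Bad} bad? unique xs <m with FinP.any? (λ i → all? (¬? ∘ bad? i) xs)
... | yes p = p
... | no ¬p = contradiction (FinP.injective⇒≤ position-injective) (<⇒≱ <m)
  where
  bad : ∀ i → Any (Bad i) xs
  bad i = Any.map (λ {x} → decidable-stable (bad? i x))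
    (¬All⇒Any¬ (¬? ∘ bad? i) xs λ all → ¬p (i , all))
  position : Fin m → Fin (length xs)
  position = Any.index ∘ bad
  position-injective : ∀ {i j} → position i ≡ position j → i ≡ j
  position-injective {i} {j} eq = unique (AnyP.lookup-index (bad i))
    (subst (Bad j ∘ lookup xs) (sym eq) (AnyP.lookup-index (bad j)))

-- Reversals forced into different ple's

module LowerBound (P : FinPoset) (irrefl : ∀ {x} → ¬ FinPoset._<_ P x x) (c : ℕ) where
  open FinPoset P renaming (_<_ to _≺_; _≟_ to _≟ᶜ_)
  open LocalRealizer P

  -- Compare the positions of `x` and `y′`. If `x` comes first, then `y` precedes `x′`, against
  -- `x′ ≺ y`; otherwise `x ≺ y′` is violated.
  reversals-conflict : ∀ L {x y x′ y′} → x ≺ y′ → x′ ≺ y →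
    Before P L y x → ¬ Before P L y′ x′
  reversals-conflict L x≺y′ x′≺y (i , j , i<j , refl , refl) (i′ , j′ , i′<j′ , refl , refl)
    with FinP.<-cmp j i′
  ... | tri< j<i′ _ _ = PLE.extends L i j′ (<-trans i<j (<-trans j<i′ i′<j′)) x′≺y
  ... | tri≈ _ refl _ = irrefl x≺y′
  ... | tri> _ _ i′<j = PLE.extends L i′ j i′<j x≺y′

  with∋ without∋ : Carrier → List (PLE P) → List (PLE P)
  with∋ u    = filter (λ L → u ∈? PLE.elems L)
  without∋ u = filter (λ L → ¬? (u ∈? PLE.elems L))

  μ-split : ∀ v u 𝓛 → μ P v (without∋ u 𝓛) + μ P v (with∋ u 𝓛) ≤ μ P v 𝓛
  μ-split v u [] = z≤n
  μ-split v u (L ∷ 𝓛) with u ∈? PLE.elems L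
  ... | yes _ with v ∈? PLE.elems L
  ...   | yes _ = ≤-trans (≤-reflexive (+-suc _ _)) (s≤s (μ-split v u 𝓛))
  ...   | no  _ = μ-split v u 𝓛
  μ-split v u (L ∷ 𝓛) | no _ with v ∈? PLE.elems L
  ...   | yes _ = s≤s (μ-split v u 𝓛)
  ...   | no  _ = μ-split v u 𝓛

  -- Moving the ple's that contain `u` from `𝓤` to `𝓣` loses none of them, so the reversal
  -- hypothesis survives the recursion.
  any-split : ∀ {Q : PLE P → Set} u 𝓤 𝓣 → Any Q (𝓤 ++ 𝓣) → Any Q (without∋ u 𝓤 ++ 𝓣 ++ with∋ u 𝓤)
  any-split u 𝓤 𝓣 p with AnyP.++⁻ 𝓤 p
  ... | inj₂ q = AnyP.++⁺ʳ (without∋ u 𝓤) (AnyP.++⁺ˡ q)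
  ... | inj₁ q with L , L∈ , qL ← find q with u ∈? PLE.elems L
  ...   | yes u∈L = AnyP.++⁺ʳ (without∋ u 𝓤) (AnyP.++⁺ʳ 𝓣 (lose (∈-filter⁺ _ L∈ u∈L) qL))
  ...   | no  u∉L = AnyP.++⁺ˡ (lose (∈-filter⁺ _ L∈ u∉L) qL)

  anyˡ : ∀ {Q : PLE P → Set} 𝓤 {𝓣} → Any Q (𝓤 ++ 𝓣) → All (¬_ ∘ Q) 𝓣 → Any Q 𝓤
  anyˡ 𝓤 p ¬q with AnyP.++⁻ 𝓤 p
  ... | inj₁ q = q
  ... | inj₂ q = contradiction q (All¬⇒¬Any ¬q)

  -- 𝓣 holds the ple's containing an earlier b_{i₁…i_l}; only reversals in 𝓤 are counted.
  tower : ∀ {m} e (f : Elt m e → Carrier) (𝓤 𝓣 : List (PLE P)) →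
    (∀ {x y} → KLt x y → f x ≺ f y) →
    (∀ u → μ P u 𝓤 ≤ c) → length 𝓣 + e * c < m →
    (∀ {x y} → Incomparable (Kelly (suc m) (suc e)) x y →
      Any (λ L → Before P L (f y) (f x)) (𝓤 ++ 𝓣)) →
    ∃ λ x → KLt x (bTop e) × suc e ≤ μ P (f x) 𝓤
  tower {m} zero f 𝓤 𝓣 mono μ≤c room rev =
    -- An index of the form `inject₁ i` is never the last one, which puts the chosen `a` below
    -- `bTop`.
    leaf (a (inject₁ i)) , A<B FinP.fromℕ≢inject₁ ,
    filter-some _ (Any.map (λ {L} → Before⇒∈ʳ {L}) (anyˡ 𝓤 (rev A∥B) good))
    where
    A B : Fin (suc m) → Elt m zero
    A = leaf ∘ a
    B = leaf ∘ na ∘ b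
    A<B : ∀ {i j} → j ≢ i → KLt (A i) (B j)
    A<B {i} {j} j≢i = <ᴱ⇒KLt (A i) (B j) (j≢i ∘ sym)
    -- For distinct indices each `A` lies below the other's `B`, so one ple reverses the pair of at
    -- most one index.
    clean : ∃ λ i → All (λ L → ¬ Before P L (f (B (inject₁ i))) (f (A (inject₁ i)))) 𝓣
    clean = avoid (λ i L → Before? L _ _) (λ {i} {j} {L} p q → decidable-stable (i FinP.≟ j) λ i≢j →
      reversals-conflict L (mono (A<B (i≢j ∘ sym ∘ FinP.inject₁-injective)))
        (mono (A<B (i≢j ∘ FinP.inject₁-injective))) p q)
      𝓣 (≤-<-trans (m≤m+n _ _) room)
    i    = proj₁ clean
    good = proj₂ clean
    A∥B : Incomparable (Kelly (suc m) 1) (A (inject₁ i)) (B (inject₁ i))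
    A∥B = (λ ()) , (λ p → KLt⇒<ᴱ p refl) , KLt⇒<ᴱ
  -- The recursion runs in copy `i′` with the ple's containing `v` moved into `𝓣`, so it counts only
  -- ple's avoiding `v`.
  tower {m} (suc e) f 𝓤 𝓣 mono μ≤c room rev = step (tower e (f ∘ sub i′)
      (without∋ v 𝓤) (𝓣 ++ with∋ v 𝓤)
      (mono ∘ sub-mono i′)
      (λ u → ≤-trans (≤-trans (m≤m+n _ _) (μ-split u v 𝓤)) (μ≤c u))
      room′
      (λ x∥y → any-split v 𝓤 𝓣 (rev (sub-∥ x∥y))))
    where
    S : Fin (suc m) → Elt m e → Elt m (suc e)
    S = sub
    B : Fin (suc m) → Elt m (suc e)
    B = top ∘ b
    x<B : ∀ {i j x} → KLt x (bTop e) → j ≢ i → KLt (S i x) (B j)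
    x<B {i} {j} {x} p j≢i = <ᴱ⇒KLt (S i x) (B j) (inj₂ (KLt⇒<ᴱ p) , j≢i ∘ sym)
    -- Badness ranges over every `x` below `bTop e`, since the index is fixed before the recursion
    -- produces `x`.
    Bad : Fin m → PLE P → Set
    Bad i L = ∃ λ x → KLt x (bTop e) × Before P L (f (B (inject₁ i))) (f (S (inject₁ i) x))
    clean : ∃ λ i → All (¬_ ∘ Bad i) 𝓣
    clean = avoid
      (λ i L → Decide.∃? _ (kellyFinite m e) λ x → x <ᴸ? bTop e ×-dec Before? L _ _)
      (λ {i} {j} {L} (x , x< , p) (y , y< , q) → decidable-stable (i FinP.≟ j) λ i≢j →
        reversals-conflict L (mono (x<B x< (i≢j ∘ sym ∘ FinP.inject₁-injective)))
          (mono (x<B y< (i≢j ∘ FinP.inject₁-injective))) p q)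
      𝓣 (≤-<-trans (m≤m+n _ _) room)
    i    = proj₁ clean
    good = proj₂ clean
    i′   = inject₁ i
    v    = f (B i′)
    -- The added part has length `μ P v 𝓤`, at most `c`, so each level spends one summand of the
    -- reserve `suc e * c`.
    room′ : length (𝓣 ++ with∋ v 𝓤) + e * c < m
    room′ = ≤-<-trans (begin
      length (𝓣 ++ with∋ v 𝓤) + e * c    ≡⟨ cong (_+ e * c) (length-++ 𝓣) ⟩
      length 𝓣 + μ P v 𝓤 + e * c         ≤⟨ +-monoˡ-≤ (e * c) (+-monoʳ-≤ (length 𝓣) (μ≤c v)) ⟩
      length 𝓣 + c + e * c               ≡⟨ +-assoc (length 𝓣) c (e * c) ⟩
      length 𝓣 + suc e * c               ∎) room
      where open ≤-Reasoning
    sub-∥ : ∀ {x y} → Incomparable (Kelly (suc m) (suc e)) x y →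
      Incomparable (Kelly (suc m) (suc (suc e))) (S i′ x) (S i′ y)
    sub-∥ {x} {y} (x≢y , x≮y , y≮x) = (λ { refl → x≢y refl }) ,
      (x≮y ∘ <ᴱ⇒KLt x y ∘ proj₂ ∘ KLt⇒<ᴱ) , (y≮x ∘ <ᴱ⇒KLt y x ∘ proj₂ ∘ KLt⇒<ᴱ)
    step : (∃ λ x → KLt x (bTop e) × suc e ≤ μ P (f (S i′ x)) (without∋ v 𝓤)) →
      ∃ λ x → KLt x (bTop (suc e)) × suc (suc e) ≤ μ P (f x) 𝓤
    step (x , x< , many) = S i′ x , x<B x< FinP.fromℕ≢inject₁ , (begin
      suc (suc e)                                           ≡⟨ +-comm 1 (suc e) ⟩
      suc e + 1                                             ≤⟨ +-mono-≤ many extra ⟩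
      μ P u (without∋ v 𝓤) + μ P u (with∋ v 𝓤)            ≤⟨ μ-split u v 𝓤 ⟩
      μ P u 𝓤                                              ∎)
      where
      open ≤-Reasoning
      u = f (S i′ x)
      x∥B : Incomparable (Kelly (suc m) (suc (suc e))) (S i′ x) (B i′)
      x∥B = (λ ()) , (λ p → proj₂ (KLt⇒<ᴱ p) refl) , KLt⇒<ᴱ
      -- The choice of `i` rules out a reversal in `𝓣`.
      reversed : Any (λ L → Before P L v u) 𝓤
      reversed = anyˡ 𝓤 (rev x∥B) (All.map (λ ¬bad p → ¬bad (x , x< , p)) good)
      extra : 1 ≤ μ P u (with∋ v 𝓤)
      -- The reversing ple contains `v`, so it is not among those counted in `without∋ v 𝓤`.
      extra with L , L∈ , p ← find reversed =
        filter-some _ (lose (∈-filter⁺ _ L∈ (Before⇒∈ˡ {L} p)) (Before⇒∈ʳ {L} p))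

-- With `𝓣` empty and `c = e`, the room that `tower` asks for is `e * e < m`; its element then lies
-- in more than `e` ple's.
kelly-¬HasRealizer : ∀ m e → e * e < m → ¬ LocalRealizer.HasRealizer (Kelly (suc m) (suc e)) e
kelly-¬HasRealizer m e e²<m (𝓛 , (_ , inc) , μ≤e)
  with x , _ , many ← LowerBound.tower (Kelly (suc m) (suc e)) KLt-irrefl e e id 𝓛 []
         id μ≤e e²<m (λ {x} {y} x∥y → AnyP.++⁺ˡ (inc x y x∥y))
  = <⇒≱ many (μ≤e x)

-- The least threshold

kelly-relation : ∀ m e → ∃ λ x → KLt {suc m} {e} x (bTop e)
-- With `suc m` as parameter there are at least two indices, so the first differs from the last. The
-- comparable pair makes the local dimension positive.
kelly-relation m zero    = leaf (a fzero) , <ᴱ⇒KLt (leaf (a fzero)) (bTop zero) λ ()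
kelly-relation m (suc e) = sub fzero (bTop e) ,
  <ᴱ⇒KLt (sub fzero (bTop e)) (bTop (suc e)) (inj₁ refl , λ ())

ldimAtLeast-kelly? : ∀ m e → Dec (LdimAtLeast (Kelly (suc (suc m)) (suc e)) (suc e))
ldimAtLeast-kelly? m e =
  Decide.ldimAtLeast? _ (kellyFinite (suc m) e) (proj₂ (kelly-relation m e)) e

-- Descends from a known threshold until `Q` fails just below it or 2 is reached. A failure at
-- `2 + N` rules out every threshold up to `2 + N`.
leastThreshold : ∀ {Q : ℕ → Set} → (∀ m → Dec (Q (2 + m))) → ∀ N → (∀ n → 2 + N ≤ n → Q n) →
  Σ ℕ λ nd → 2 ≤ nd × (∀ n → nd ≤ n → Q n) × (∀ n′ → 2 ≤ n′ → (∀ n → n′ ≤ n → Q n) → nd ≤ n′)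
leastThreshold Q? zero Q≥ = 2 , ≤-refl , Q≥ , λ _ 2≤n′ _ → 2≤n′
leastThreshold {Q} Q? (suc N) Q≥ with Q? N
... | yes q = leastThreshold Q? N λ n N≤n → [ Q≥ n , (λ { refl → q }) ]′ (m≤n⇒m<n∨m≡n N≤n)
... | no ¬q = 3 + N , s≤s (s≤s z≤n) , Q≥ , λ n′ _ Q≥′ → ≰⇒> λ n′≤ → ¬q (Q≥′ (2 + N) n′≤)

theorem10 : ∀ (d : ℕ) → 1 ≤ d →
    Σ ℕ λ nd → 2 ≤ nd ×
    (∀ n → nd ≤ n → LdimAtLeast (Kelly n d) d) ×
    (∀ n' → 2 ≤ n' → (∀ n → n' ≤ n → LdimAtLeast (Kelly n d) d) → nd ≤ n')
theorem10 (suc e) _ = leastThreshold (λ m → ldimAtLeast-kelly? m e) (e * e) large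
  where
  large : ∀ n → 2 + e * e ≤ n → LdimAtLeast (Kelly n (suc e)) (suc e)
  -- Here `n` is `suc (suc m)`, so the lower bound is used with `suc m` as its `m`, and
  -- `2 + e * e ≤ n` is exactly `e * e < suc m`.
  large (suc (suc m)) (s≤s e²<m) = Decide.¬HasRealizer⇒LdimAtLeast _ (kellyFinite (suc m) e)
    (proj₂ (kelly-relation m e)) (kelly-¬HasRealizer (suc m) e e²<m)
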